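{- For every positive integer $n$, $$\sum_{\lambda \in \mathcal{H}_n} t^{\mathrm{rep}(\lambda)} = \sum_{\lambda \in \mathcal{H}_n} t^{\mathrm{even}(\lambda)}$$ as polynomials in $t$.
   Context: A partition is a finite nonempty weakly decreasing sequence $\lambda=(\lambda_1,\ldots,\lambda_k)$ of positive integers; $\ell(\lambda)=k$ is its number of parts. The perimeter of $\lambda$ is $\Gamma(\lambda)=\lambda_1+\ell(\lambda)-1$, and $\mathcal{H}_n$ is the (finite) set of partitions with perimeter $n$. For a partition $\lambda$, $\mathrm{rep}(\lambda)=|\{1\le i\le \ell(\lambda)-1:\lambda_i=\lambda_{i+1}\}|$ and $\mathrm{even}(\lambda)=|\{1\le i\le \ell(\lambda): \lambda_i \text{ is even}\}|$. -}

module Defs where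

open import Data.Nat using (ℕ; zero; suc; _+_; _∸_; _≤_; _<_; _≥_; s≤s)
open import Data.Nat.Properties using (_≟_; _<?_; _≥?_; ≤-trans; ≤-reflexive; m≤m+n; m≤n+m; +-suc)
open import Data.Nat.Divisibility using (_∣?_)
open import Data.List using (List; []; _∷_; length; filter; foldr; zip; upTo; cartesianProductWith)
open import Data.List.NonEmpty as List⁺ using (List⁺; _∷_; toList)
open import Data.List.Relation.Unary.All as All using (All; []; _∷_; all?)
open import Data.List.Relation.Unary.AllPairs using ([]; _∷_)
open import Data.List.Relation.Unary.Any using (here; there)
open import Data.List.Relation.Unary.Linked using (Linked; []; [-]; _∷_; linked?)
open import Data.List.Relation.Unary.Unique.Propositional using (Unique)
open import Data.List.Relation.Unary.Unique.Propositional.Properties using (cartesianProductWith⁺; filter⁺; upTo⁺)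
open import Data.List.Membership.Propositional using (_∈_)
open import Data.List.Membership.Propositional.Properties using (∈-cartesianProductWith⁺; ∈-cartesianProductWith⁻; ∈-filter⁺; ∈-filter⁻; ∈-upTo⁺)
open import Data.Product using (_×_; _,_; proj₂; uncurry)
open import Function.Bundles using (_⇔_; mk⇔)
open import Relation.Binary.PropositionalEquality using (_≡_; _≢_; refl; sym; trans; cong)
open import Relation.Nullary using (Dec; _×-dec_)

IsPartition : List⁺ ℕ → Set
IsPartition ν = Linked _≥_ (toList ν) × All (0 <_) (toList ν)

ℓ : List⁺ ℕ → ℕ
ℓ = List⁺.length

Γ : List⁺ ℕ → ℕ
Γ ν = List⁺.head ν + ℓ ν ∸ 1

-- The pairs (νᵢ , νᵢ₊₁), 1 ≤ i ≤ ℓ ν − 1, are obtained by zipping ν with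
-- its tail.
rep : List⁺ ℕ → ℕ
rep ν = length (filter (uncurry _≟_) (zip (toList ν) (List⁺.tail ν)))

even : List⁺ ℕ → ℕ
even ν = length (filter (2 ∣?_) (toList ν))

InH : ℕ → List⁺ ℕ → Set
InH n ν = IsPartition ν × Γ ν ≡ n

inH? : ∀ n ν → Dec (InH n ν)
inH? n ν = (linked? _≥?_ (toList ν) ×-dec all? (0 <?_) (toList ν)) ×-dec (Γ ν ≟ n)

-- All lists with entries ≤ m and length ≤ k.
boundedLists : ℕ → ℕ → List (List ℕ)
boundedLists m zero    = [] ∷ []
boundedLists m (suc k) = [] ∷ cartesianProductWith _∷_ (upTo (suc m)) (boundedLists m k)

-- A partition of perimeter n has all parts and its length ≤ n, so filtering
-- the bounded sequences misses nothing; see ∈-H and H-unique.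
H : ℕ → List (List⁺ ℕ)
H n = filter (inH? n) (cartesianProductWith _∷_ (upTo (suc n)) (boundedLists n n))

private
  ∈-boundedLists : ∀ {m} k {xs} → All (_≤ m) xs → length xs ≤ k → xs ∈ boundedLists m k
  ∈-boundedLists zero    []       _       = here refl
  ∈-boundedLists (suc k) []       _       = here refl
  ∈-boundedLists (suc k) (p ∷ ps) (s≤s l) =
    there (∈-cartesianProductWith⁺ _∷_ (∈-upTo⁺ (s≤s p)) (∈-boundedLists k ps l))

  boundedLists-unique : ∀ m k → Unique (boundedLists m k)
  boundedLists-unique m zero    = [] ∷ []
  boundedLists-unique m (suc k) =
    All.tabulate []≢ ∷
    cartesianProductWith⁺ _∷_ (λ { refl → refl , refl }) (upTo⁺ (suc m)) (boundedLists-unique m k)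
    where
    []≢ : ∀ {xs} → xs ∈ cartesianProductWith _∷_ (upTo (suc m)) (boundedLists m k) → [] ≢ xs
    []≢ i refl with () ← proj₂ (proj₂ (proj₂ (proj₂ (∈-cartesianProductWith⁻ _∷_ (upTo (suc m)) (boundedLists m k) i))))

  tail-bounded : ∀ {m x xs} → x ≤ m → Linked _≥_ (x ∷ xs) → All (_≤ m) xs
  tail-bounded x≤m [-]        = []
  tail-bounded x≤m (x≥y ∷ ys) = ≤-trans x≥y x≤m ∷ tail-bounded (≤-trans x≥y x≤m) ys

∈-H : ∀ n ν → ν ∈ H n ⇔ InH n ν
∈-H n (x ∷ xs) = mk⇔ (λ i → proj₂ (∈-filter⁻ (inH? n) {xs = candidates} i)) complete
  where
  candidates : List (List⁺ ℕ)
  candidates = cartesianProductWith _∷_ (upTo (suc n)) (boundedLists n n)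

  complete : InH n (x ∷ xs) → (x ∷ xs) ∈ H n
  complete inH@((decr , _) , Γ≡n) =
    ∈-filter⁺ (inH? n)
      (∈-cartesianProductWith⁺ _∷_ (∈-upTo⁺ (s≤s x≤n))
        (∈-boundedLists n (tail-bounded x≤n decr) l≤n))
      inH
    where
    x+l≡n : x + length xs ≡ n
    x+l≡n = trans (sym (cong (_∸ 1) (+-suc x (length xs)))) Γ≡n
    x≤n : x ≤ n
    x≤n = ≤-trans (m≤m+n x (length xs)) (≤-reflexive x+l≡n)
    l≤n : length xs ≤ n
    l≤n = ≤-trans (m≤n+m (length xs) x) (≤-reflexive x+l≡n)

H-unique : ∀ n → Unique (H n)
H-unique n = filter⁺ (inH? n)
  (cartesianProductWith⁺ _∷_ (λ { refl → refl , refl }) (upTo⁺ (suc n)) (boundedLists-unique n n))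

-- Coefficient lists, constant term first; trailing zeros are allowed, so
-- equality of polynomials is _≈_ and not _≡_.
Poly : Set
Poly = List ℕ

coeff : Poly → ℕ → ℕ
coeff []      _       = 0
coeff (a ∷ p) zero    = a
coeff (a ∷ p) (suc i) = coeff p i

infix 4 _≈_
_≈_ : Poly → Poly → Set
p ≈ q = ∀ i → coeff p i ≡ coeff q i

infixl 6 _⊕_
_⊕_ : Poly → Poly → Poly
[]      ⊕ q       = q
(a ∷ p) ⊕ []      = a ∷ p
(a ∷ p) ⊕ (b ∷ q) = (a + b) ∷ (p ⊕ q)

infix 8 t^_
t^_ : ℕ → Poly
t^ zero  = 1 ∷ []
t^ suc k = 0 ∷ t^ k

∑ : {A : Set} → List A → (A → Poly) → Poly
∑ xs f = foldr (λ x p → f x ⊕ p) [] xs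

infix 5 ∑
syntax ∑ xs (λ x → p) = ∑[ x ∈ xs ] p

{-# OPTIONS --safe #-}
-- Every partition arises from (1) in exactly one way by repeating its largest
-- part or increasing its largest part by one, and each of these moves raises
-- the perimeter by one.  Record b = [λ₁ = λ₂] and j = rep (λ₂, λ₃, …), so that
-- rep λ = j + b: repeating leads to (1 , j + b), increasing to (0 , j).
-- Record instead b = [λ₁ even] and j = even (λ₂, λ₃, …): the two moves lead to
-- the same two pairs, in the opposite order when λ₁ is odd.  Hence both
-- statistics have the same distribution in every perimeter.
module Submission where

open import Defs
open import Data.Bool using (Bool; true; false; not; if_then_else_)
open import Data.List using (List; []; _∷_; [_]; _++_; map; length; filter)
open import Data.List.Membership.Propositional using (_∈_)
open import Data.List.Membership.Propositional.Properties using (∈-++⁺ˡ; ∈-++⁺ʳ; ∈-++⁻; ∈-map⁺; ∈-map⁻)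
open import Data.List.Membership.Propositional.Properties.WithK using (unique∧set⇒bag)
open import Data.List.NonEmpty using (List⁺; _∷_)
open import Data.List.Properties using (map-++; map-∘; map-cong)
open import Data.List.Relation.Binary.BagAndSetEquality using (∼bag⇒↭)
open import Data.List.Relation.Binary.Disjoint.Propositional using (Disjoint)
open import Data.List.Relation.Binary.Permutation.Propositional using (_↭_; ↭-refl; ↭-reflexive; ↭-sym; ↭-trans; ↭-prep; ↭-swap; module PermutationReasoning)
open import Data.List.Relation.Binary.Permutation.Propositional.Properties using (map⁺; ++⁺; shift)
open import Data.List.Relation.Unary.All as All using (All; []; _∷_)
open import Data.List.Relation.Unary.AllPairs using ([]; _∷_)
open import Data.List.Relation.Unary.Any using (here)
open import Data.List.Relation.Unary.Linked using ([-]; _∷_)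
open import Data.List.Relation.Unary.Unique.Propositional using (Unique)
import Data.List.Relation.Unary.Unique.Propositional.Properties as Unique
open import Data.Nat using (ℕ; zero; suc; _+_; _<_; _≟_; z≤n; s≤s)
open import Data.Nat.Divisibility using (_∣?_)
open import Data.Nat.ListAction using (sum)
open import Data.Nat.ListAction.Properties using (sum-↭)
open import Data.Nat.Properties using (+-suc; +-identityʳ; ≤-refl; ≤-trans; <-irrefl; m≤n⇒m≤1+n; m≤n⇒m<n∨m≡n; suc-injective)
open import Data.Product using (_×_; _,_; ∃; proj₁; proj₂)
open import Data.Sum using (_⊎_; inj₁; inj₂)
open import Function using (_∘_)
open import Function.Bundles using (mk⇔; module Equivalence)
open import Relation.Binary.PropositionalEquality using (_≡_; _≗_; refl; sym; trans; cong; cong₂; module ≡-Reasoning)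
open import Relation.Nullary using (¬_; does; contradiction)
open import Relation.Nullary.Decidable using (dec-true; dec-false)

repeatMax : List⁺ ℕ → List⁺ ℕ
repeatMax (x ∷ xs) = x ∷ x ∷ xs

incrementMax : List⁺ ℕ → List⁺ ℕ
incrementMax (x ∷ xs) = suc x ∷ xs

repeatMax-injective : ∀ {μ ν} → repeatMax μ ≡ repeatMax ν → μ ≡ ν
repeatMax-injective {_ ∷ _} {_ ∷ _} refl = refl

incrementMax-injective : ∀ {μ ν} → incrementMax μ ≡ incrementMax ν → μ ≡ ν
incrementMax-injective {_ ∷ _} {_ ∷ _} refl = refl

repeatMax-partition : ∀ {ν} → IsPartition ν → IsPartition (repeatMax ν)
repeatMax-partition {_ ∷ _} (decr , pos ∷ poss) = ≤-refl ∷ decr , pos ∷ pos ∷ poss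

incrementMax-partition : ∀ {ν} → IsPartition ν → IsPartition (incrementMax ν)
incrementMax-partition {_ ∷ _} ([-] , _ ∷ _)           = [-] , s≤s z≤n ∷ []
incrementMax-partition {_ ∷ _} (x≥y ∷ decr , _ ∷ poss) = m≤n⇒m≤1+n x≥y ∷ decr , s≤s z≤n ∷ poss

-- The two moves have disjoint images: a common value would make `μ` begin with `x` followed by
-- `suc x`, which is not weakly decreasing.
incrementMax≢repeatMax : ∀ {μ ν} → IsPartition μ → ¬ incrementMax μ ≡ repeatMax ν
incrementMax≢repeatMax {_ ∷ _} {_ ∷ _} (x≥1+x ∷ _ , _) refl = <-irrefl refl x≥1+x

-- The first two parts reveal the last move: it was a repetition if they are equal, an increase if
-- they differ.
predecessor : ∀ {ν} → IsPartition ν →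
  ν ≡ 1 ∷ [] ⊎ ∃ λ μ → IsPartition μ × (ν ≡ repeatMax μ ⊎ ν ≡ incrementMax μ)
predecessor {suc zero ∷ []}    _ = inj₁ refl
predecessor {suc (suc x) ∷ []} _ = inj₂ (suc x ∷ [] , ([-] , s≤s z≤n ∷ []) , inj₂ refl)
predecessor {x ∷ y ∷ ys} (x≥y ∷ decr , _ ∷ poss) with m≤n⇒m<n∨m≡n x≥y
... | inj₂ refl = inj₂ (y ∷ ys , (decr , poss) , inj₁ refl)
-- The strict descent leaves room to lower the first part by one; it stays positive because
-- `0 < y ≤ x`.
predecessor {suc x ∷ y ∷ ys} (_ ∷ decr , _ ∷ 0<y ∷ poss) | inj₁ (s≤s y≤x) =
  inj₂ (x ∷ y ∷ ys , (y≤x ∷ decr , ≤-trans 0<y y≤x ∷ 0<y ∷ poss) , inj₂ refl)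

Γ-∷ : ∀ x xs → Γ (x ∷ xs) ≡ x + length xs
Γ-∷ x xs rewrite +-suc x (length xs) = refl

Γ-repeatMax : ∀ ν → Γ (repeatMax ν) ≡ suc (Γ ν)
Γ-repeatMax (x ∷ xs) rewrite Γ-∷ x (x ∷ xs) | Γ-∷ x xs = +-suc x (length xs)

Γ-incrementMax : ∀ ν → Γ (incrementMax ν) ≡ suc (Γ ν)
Γ-incrementMax (x ∷ xs) rewrite Γ-∷ x xs = +-suc x (length xs)

Γ≢0 : ∀ {ν} → IsPartition ν → ¬ Γ ν ≡ 0
Γ≢0 {suc x ∷ xs} (_ , s≤s _ ∷ _) eq with () ← trans (sym (Γ-∷ (suc x) xs)) eq

-- The partitions of perimeter k + 1.
grown : ℕ → List (List⁺ ℕ)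
grown zero    = [ 1 ∷ [] ]
grown (suc k) = map repeatMax (grown k) ++ map incrementMax (grown k)

∈-grown⁻ : ∀ k {ν} → ν ∈ grown k → InH (suc k) ν
∈-grown⁻ zero    (here refl) = ([-] , s≤s z≤n ∷ []) , refl
∈-grown⁻ (suc k) ν∈ with ∈-++⁻ (map repeatMax (grown k)) ν∈
... | inj₁ ν∈ˡ with μ , μ∈ , refl ← ∈-map⁻ repeatMax ν∈ˡ =
  let part , Γ≡ = ∈-grown⁻ k μ∈ in
  repeatMax-partition part , trans (Γ-repeatMax μ) (cong suc Γ≡)
... | inj₂ ν∈ʳ with μ , μ∈ , refl ← ∈-map⁻ incrementMax ν∈ʳ =
  let part , Γ≡ = ∈-grown⁻ k μ∈ in
  incrementMax-partition part , trans (Γ-incrementMax μ) (cong suc Γ≡)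

∈-grown⁺ : ∀ k {ν} → InH (suc k) ν → ν ∈ grown k
∈-grown⁺ k (part , Γ≡) with predecessor part
∈-grown⁺ zero    (_ , Γ≡) | inj₁ refl = here refl
∈-grown⁺ (suc k) (_ , ()) | inj₁ refl
-- A move ending in perimeter 1 would have started from perimeter 0.
∈-grown⁺ zero    (_ , Γ≡) | inj₂ (μ , part , inj₁ refl) =
  contradiction (suc-injective (trans (sym (Γ-repeatMax μ)) Γ≡)) (Γ≢0 part)
∈-grown⁺ zero    (_ , Γ≡) | inj₂ (μ , part , inj₂ refl) =
  contradiction (suc-injective (trans (sym (Γ-incrementMax μ)) Γ≡)) (Γ≢0 part)
∈-grown⁺ (suc k) (_ , Γ≡) | inj₂ (μ , part , inj₁ refl) =
  ∈-++⁺ˡ (∈-map⁺ repeatMax (∈-grown⁺ k (part , suc-injective (trans (sym (Γ-repeatMax μ)) Γ≡))))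
∈-grown⁺ (suc k) (_ , Γ≡) | inj₂ (μ , part , inj₂ refl) =
  ∈-++⁺ʳ (map repeatMax (grown k))
    (∈-map⁺ incrementMax (∈-grown⁺ k (part , suc-injective (trans (sym (Γ-incrementMax μ)) Γ≡))))

grown-unique : ∀ k → Unique (grown k)
grown-unique zero    = [] ∷ []
grown-unique (suc k) =
  Unique.++⁺ (Unique.map⁺ repeatMax-injective (grown-unique k))
             (Unique.map⁺ incrementMax-injective (grown-unique k))
             disjoint
  where
  disjoint : Disjoint (map repeatMax (grown k)) (map incrementMax (grown k))
  disjoint (ν∈ˡ , ν∈ʳ)
    with _ , _ , eqˡ ← ∈-map⁻ repeatMax ν∈ˡ | _ , μ∈ , eqʳ ← ∈-map⁻ incrementMax ν∈ʳ =
    incrementMax≢repeatMax (proj₁ (∈-grown⁻ k μ∈)) (trans (sym eqʳ) eqˡ)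

-- Both lists are free of duplicates and have the same members.
H↭grown : ∀ k → H (suc k) ↭ grown k
H↭grown k = ∼bag⇒↭ (unique∧set⇒bag (H-unique (suc k)) (grown-unique k)
  (mk⇔ (∈-grown⁺ k ∘ Equivalence.to (∈-H (suc k) _))
       (Equivalence.from (∈-H (suc k) _) ∘ ∈-grown⁻ k)))

-- A profile (b , j) consists of the contribution b of the largest part to the
-- statistic and the value j of the statistic on the remaining parts.
Profile : Set
Profile = Bool × ℕ

total : Profile → ℕ
total (b , j) = if b then suc j else j

-- After `hit` the old contribution is kept and a new one added, so the total grows by one; after
-- `miss` only the remaining parts count.
hit miss : Profile → Profile
hit  σ = true , total σ
miss σ = false , proj₂ σ

profiles : ℕ → List Profile
profiles zero    = [ false , 0 ]
profiles (suc k) = map hit (profiles k) ++ map miss (profiles k)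

-- The pairs are matched separately at each `x`, since which of `f′ x` and `g′ x` equals `f x` may
-- vary with `x`.
map-++-↭ : ∀ {A B : Set} {f g f′ g′ : A → B} {xs} →
  All (λ x → f x ∷ g x ∷ [] ↭ f′ x ∷ g′ x ∷ []) xs →
  map f xs ++ map g xs ↭ map f′ xs ++ map g′ xs
map-++-↭ [] = ↭-refl
map-++-↭ {f = f} {g} {f′} {g′} {x ∷ xs} (p ∷ ps) = begin
  f x ∷ map f xs ++ g x ∷ map g xs       ↭⟨ ↭-prep (f x) (shift (g x) (map f xs) (map g xs)) ⟩
  f x ∷ g x ∷ map f xs ++ map g xs       ↭⟨ ++⁺ p (map-++-↭ ps) ⟩
  f′ x ∷ g′ x ∷ map f′ xs ++ map g′ xs   ↭⟨ ↭-prep (f′ x) (shift (g′ x) (map f′ xs) (map g′ xs)) ⟨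
  f′ x ∷ map f′ xs ++ g′ x ∷ map g′ xs   ∎
  where open PermutationReasoning

-- Up to order, the profile before a move determines the two profiles after it. The multiset of
-- profiles in each perimeter is therefore the same for every such `s`.
module _ (s : List⁺ ℕ → Profile) (s-one : s (1 ∷ []) ≡ (false , 0))
  (s-step : ∀ ν → IsPartition ν →
    s (repeatMax ν) ∷ s (incrementMax ν) ∷ [] ↭ hit (s ν) ∷ miss (s ν) ∷ [])
  where

  map-grown-↭ : ∀ k → map s (grown k) ↭ profiles k
  map-grown-↭ zero    = ↭-reflexive (cong [_] s-one)
  map-grown-↭ (suc k) = begin
    map s (map repeatMax (grown k) ++ map incrementMax (grown k))
      ≡⟨ map-++ s (map repeatMax (grown k)) (map incrementMax (grown k)) ⟩
    map s (map repeatMax (grown k)) ++ map s (map incrementMax (grown k))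
      ≡⟨ cong₂ _++_ (map-∘ (grown k)) (map-∘ (grown k)) ⟨
    map (s ∘ repeatMax) (grown k) ++ map (s ∘ incrementMax) (grown k)
      ↭⟨ map-++-↭ (All.tabulate (λ ν∈ → s-step _ (proj₁ (∈-grown⁻ k ν∈)))) ⟩
    map (hit ∘ s) (grown k) ++ map (miss ∘ s) (grown k)
      ≡⟨ cong₂ _++_ (map-∘ (grown k)) (map-∘ (grown k)) ⟩
    map hit (map s (grown k)) ++ map miss (map s (grown k))
      ↭⟨ ++⁺ (map⁺ hit (map-grown-↭ k)) (map⁺ miss (map-grown-↭ k)) ⟩
    map hit (profiles k) ++ map miss (profiles k) ∎
    where open PermutationReasoning

  map-H-↭ : ∀ {f} → f ≗ total ∘ s → ∀ k → map f (H (suc k)) ↭ map total (profiles k)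
  map-H-↭ {f} f≗ k = begin
    map f (H (suc k))           ↭⟨ map⁺ f (H↭grown k) ⟩
    map f (grown k)             ≡⟨ map-cong f≗ (grown k) ⟩
    map (total ∘ s) (grown k)   ≡⟨ map-∘ (grown k) ⟩
    map total (map s (grown k)) ↭⟨ map⁺ total (map-grown-↭ k) ⟩
    map total (profiles k)      ∎
    where open PermutationReasoning

repProfile : List⁺ ℕ → Profile
repProfile (x ∷ [])     = false , 0
repProfile (x ∷ y ∷ ys) = does (x ≟ y) , rep (y ∷ ys)

rep≗total : rep ≗ total ∘ repProfile
rep≗total (x ∷ []) = refl
rep≗total (x ∷ y ∷ ys) with does (x ≟ y)
... | true  = refl
... | false = refl

-- Repetition makes the first two parts equal, and an increase makes the first strictly larger than
-- any second part, so here the order is always the same.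
repProfile-step : ∀ ν → IsPartition ν →
  repProfile (repeatMax ν) ∷ repProfile (incrementMax ν) ∷ [] ↭ hit (repProfile ν) ∷ miss (repProfile ν) ∷ []
repProfile-step ν@(x ∷ xs) part = ↭-reflexive (cong₂ (λ σ τ → σ ∷ τ ∷ [])
  (cong₂ _,_ (dec-true (x ≟ x) refl) (rep≗total ν)) (increment ν part))
  where
  increment : ∀ ν → IsPartition ν → repProfile (incrementMax ν) ≡ miss (repProfile ν)
  increment (x ∷ [])     _             = refl
  increment (x ∷ y ∷ ys) (x≥y ∷ _ , _) =
    cong (_, rep (y ∷ ys)) (dec-false (suc x ≟ y) λ { refl → <-irrefl refl x≥y })

2∣-suc : ∀ n → does (2 ∣? suc n) ≡ not (does (2 ∣? n))
2∣-suc zero          = refl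
2∣-suc (suc zero)    = refl
-- Division by 2 computes by removing two successors at a time.
2∣-suc (suc (suc n)) = 2∣-suc n

evenProfile : List⁺ ℕ → Profile
evenProfile (x ∷ xs) = does (2 ∣? x) , length (filter (2 ∣?_) xs)

even≗total : even ≗ total ∘ evenProfile
even≗total (x ∷ xs) with does (2 ∣? x)
... | true  = refl
... | false = refl

evenProfile-step : ∀ ν → IsPartition ν →
  evenProfile (repeatMax ν) ∷ evenProfile (incrementMax ν) ∷ [] ↭ hit (evenProfile ν) ∷ miss (evenProfile ν) ∷ []
evenProfile-step (x ∷ xs) _ rewrite 2∣-suc x with does (2 ∣? x)
... | true  = ↭-refl
-- For odd `x`, repeating adds no even part, while increasing turns the largest part even.
... | false = ↭-swap _ _ ↭-refl

coeff-⊕ : ∀ p q i → coeff (p ⊕ q) i ≡ coeff p i + coeff q i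
coeff-⊕ []      q       i       = refl
coeff-⊕ (a ∷ p) []      i       = sym (+-identityʳ _)
coeff-⊕ (a ∷ p) (b ∷ q) zero    = refl
coeff-⊕ (a ∷ p) (b ∷ q) (suc i) = coeff-⊕ p q i

coeff-∑ : ∀ {A : Set} (xs : List A) f i → coeff (∑ xs f) i ≡ sum (map (λ x → coeff (f x) i) xs)
coeff-∑ []       f i = refl
coeff-∑ (x ∷ xs) f i = trans (coeff-⊕ (f x) (∑ xs f) i) (cong (coeff (f x) i +_) (coeff-∑ xs f i))

-- Each coefficient is a sum over the exponents, so it depends only on their multiset.
∑-t^-↭ : ∀ {A : Set} {f g : A → ℕ} {xs} → map f xs ↭ map g xs → ∑[ x ∈ xs ] t^ f x ≈ ∑[ x ∈ xs ] t^ g x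
∑-t^-↭ {f = f} {g} {xs} p i = begin
  coeff (∑[ x ∈ xs ] t^ f x) i                ≡⟨ coeff-∑ xs (t^_ ∘ f) i ⟩
  sum (map (λ x → coeff (t^ f x) i) xs)       ≡⟨ cong sum (map-∘ xs) ⟩
  sum (map (λ k → coeff (t^ k) i) (map f xs)) ≡⟨ sum-↭ (map⁺ (λ k → coeff (t^ k) i) p) ⟩
  sum (map (λ k → coeff (t^ k) i) (map g xs)) ≡⟨ cong sum (map-∘ xs) ⟨
  sum (map (λ x → coeff (t^ g x) i) xs)       ≡⟨ coeff-∑ xs (t^_ ∘ g) i ⟨
  coeff (∑[ x ∈ xs ] t^ g x) i                ∎
  where open ≡-Reasoning

theorem1p3 : (n : ℕ) → 0 < n → ∑[ ν ∈ H n ] t^ rep ν ≈ ∑[ ν ∈ H n ] t^ even ν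
-- Both multisets of values are that of `map total (profiles k)`.
theorem1p3 (suc k) _ = ∑-t^-↭ (↭-trans
  (map-H-↭ repProfile refl repProfile-step rep≗total k)
  (↭-sym (map-H-↭ evenProfile refl evenProfile-step even≗total k)))
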